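{- Let $q$ be a prime power, let $n\geq 2$ be an integer and let $d$ be an integer with $0\leq d\leq \lfloor n^2/4\rfloor$. The number of distance vectors in $\mathcal{D}(n)$ corresponding to the flag distance value $d$, i.e. the cardinality of $\mathcal{D}(d,n)$, equals the number $T(n,d)$ of Motzkin paths $p\in\mathcal{M}_n$ such that $A(p)=d$.
   Context: Let $\mathbb{F}_q$ be the finite field with $q$ elements. A full flag on $\mathbb{F}_q^n$ is a sequence $\mathcal{F}=(\mathcal{F}_1,\dots,\mathcal{F}_{n-1})$ of $\mathbb{F}_q$-subspaces of $\mathbb{F}_q^n$ with $\mathcal{F}_1\subsetneq\cdots\subsetneq\mathcal{F}_{n-1}$ and $\dim \mathcal{F}_i=i$ for every $i$; the set of all full flags is the full flag variety $\mathcal{F}_q(n)$. For subspaces $\mathcal{U},\mathcal{V}$ of the same dimension $k$, the injection distance is $d_I(\mathcal{U},\mathcal{V})=k-\dim(\mathcal{U}\cap\mathcal{V})$. The distance vector of $\mathcal{F},\mathcal{F}'\in\mathcal{F}_q(n)$ is $\mathbf{d}(\mathcal{F},\mathcal{F}')=(d_I(\mathcal{F}_1,\mathcal{F}'_1),\dots,d_I(\mathcal{F}_{n-1},\mathcal{F}'_{n-1}))\in\mathbb{Z}^{n-1}$; the flag distance $d_f(\mathcal{F},\mathcal{F}')=\sum_{i=1}^{n-1} d_I(\mathcal{F}_i,\mathcal{F}'_i)$ is the sum of its components. Put $\mathcal{D}(n)=\{\mathbf{d}(\mathcal{F},\mathcal{F}') \mid \mathcal{F},\mathcal{F}'\in\mathcal{F}_q(n)\}$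 and $\mathcal{D}(d,n)=\{\mathbf{d}(\mathcal{F},\mathcal{F}') \mid \mathcal{F},\mathcal{F}'\in\mathcal{F}_q(n),\ d_f(\mathcal{F},\mathcal{F}')=d\}$ (pairs with $\mathcal{F}=\mathcal{F}'$ are allowed). The maximum possible flag distance in $\mathcal{F}_q(n)$ is $\lfloor n^2/4\rfloor$. A Motzkin path of length $n$ is a lattice path in $\mathbb{Z}^2$ from $(0,0)$ to $(n,0)$ with steps $U=(1,1)$, $D=(1,-1)$, $H=(1,0)$ that never runs below the $x$-axis; $\mathcal{M}_n$ is the set of these. The area $A(p)$ of a Motzkin path $p$ is the area of the region above the $x$-axis and below $p$. $T(n,k)$ denotes the number of Motzkin paths of length $n$ and area $k$ (sequence A129181 in the OEIS). -}

module Defs where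

open import Algebra.Bundles using (CommutativeRing)
import Algebra.Properties.Semiring.Sum as SemiringSum
open import Data.Fin.Base as Fin using (Fin; toℕ)
open import Data.Integer.Base as ℤ using (ℤ; +_)
import Data.Integer.Properties as ℤ
open import Data.List.Base as List using (List)
open import Data.Nat.Base as ℕ using (ℕ; zero; suc; _∸_)
open import Data.Nat.Primality using (Prime)
open import Data.Product.Base using (Σ; ∃; ∃-syntax; _×_; _,_; proj₁)
open import Data.Rational.Base as ℚ using (ℚ)
import Data.Rational.Properties as ℚ
open import Data.Vec.Base as Vec using (Vec; []; _∷_)
open import Data.Vec.Functional using (Vector)
open import Data.Vec.Relation.Unary.All as All using (All)
open import Function.Bundles using (Inverse)
open import Level using (Level; _⊔_) renaming (suc to lsuc)
open import Relation.Binary.Bundles using (Setoid)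
import Relation.Binary.Construct.On as On
open import Relation.Binary.PropositionalEquality.Core using (_≡_)
import Relation.Binary.PropositionalEquality.Properties as ≡
open import Relation.Nullary.Decidable using (Dec; _×-dec_)
open import Relation.Nullary.Negation using (¬_)
open import Relation.Unary using (Pred; _⊆_; _⊂_; _∈_; _∩_)

private
  variable
    a b c ℓ p : Level

------------------------------------------------------------------------
-- Cardinality

HasCardinality : Setoid a ℓ → ℕ → Set (a ⊔ ℓ)
HasCardinality S N = Inverse (≡.setoid (Fin N)) S

-- A subset as a setoid: membership proofs are ignored when comparing
-- elements.
subset : {A : Set a} → Pred A p → Setoid (a ⊔ p) a
subset {A = A} P = On.setoid {B = Σ A P} (≡.setoid A) proj₁

------------------------------------------------------------------------
-- Finite fields

IsPrimePower : ℕ → Set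
IsPrimePower q = ∃[ p ] ∃[ k ] Prime p × 1 ℕ.≤ k × q ≡ p ℕ.^ k

record FiniteField c ℓ (q : ℕ) : Set (lsuc (c ⊔ ℓ)) where
  field
    commutativeRing : CommutativeRing c ℓ

  open CommutativeRing commutativeRing public

  field
    0≉1         : ¬ (0# ≈ 1#)
    inverse     : ∀ x → ¬ (x ≈ 0#) → ∃[ y ] (x * y ≈ 1#)
    cardinality : HasCardinality setoid q

------------------------------------------------------------------------
-- Subspaces of the coordinate space, flags and distance vectors

module Flags {c ℓ q} (𝔽 : FiniteField c ℓ q) where
  open FiniteField 𝔽
  open SemiringSum semiring using (sum)

  Coord : ℕ → Set c
  Coord n = Vector Carrier n

  infix 4 _≋_
  _≋_ : ∀ {n} → Coord n → Coord n → Set ℓ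
  x ≋ y = ∀ i → x i ≈ y i

  0ᵥ : ∀ {n} → Coord n
  0ᵥ i = 0#

  infixl 6 _+ᵥ_
  _+ᵥ_ : ∀ {n} → Coord n → Coord n → Coord n
  (x +ᵥ y) i = x i + y i

  infixr 7 _*ᵥ_
  _*ᵥ_ : ∀ {n} → Carrier → Coord n → Coord n
  (s *ᵥ x) i = s * x i

  -- The level c ⊔ ℓ is that of the span of a finite family, so every
  -- subspace is represented.
  record Subspace (n : ℕ) : Set (lsuc (c ⊔ ℓ)) where
    field
      ⟦_⟧      : Pred (Coord n) (c ⊔ ℓ)
      resp     : ∀ {x y} → x ≋ y → x ∈ ⟦_⟧ → y ∈ ⟦_⟧
      0-closed : 0ᵥ ∈ ⟦_⟧
      +-closed : ∀ {x y} → x ∈ ⟦_⟧ → y ∈ ⟦_⟧ → x +ᵥ y ∈ ⟦_⟧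
      *-closed : ∀ s {x} → x ∈ ⟦_⟧ → s *ᵥ x ∈ ⟦_⟧

  open Subspace public using (⟦_⟧)

  infixr 7 _⊓_
  _⊓_ : ∀ {n} → Subspace n → Subspace n → Subspace n
  U ⊓ V = record
    { ⟦_⟧      = ⟦ U ⟧ ∩ ⟦ V ⟧
    ; resp     = λ x≋y (u , v) → U.resp x≋y u , V.resp x≋y v
    ; 0-closed = U.0-closed , V.0-closed
    ; +-closed = λ (u , v) (u′ , v′) → U.+-closed u u′ , V.+-closed v v′
    ; *-closed = λ s (u , v) → U.*-closed s u , V.*-closed s v
    }
    where
    module U = Subspace U
    module V = Subspace V

  linComb : ∀ {n k} → Vector Carrier k → Vector (Coord n) k → Coord n
  linComb s b i = sum (λ j → s j * b j i)

  LinearlyIndependent : ∀ {n k} → Vector (Coord n) k → Set (c ⊔ ℓ)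
  LinearlyIndependent b = ∀ s → linComb s b ≋ 0ᵥ → ∀ j → s j ≈ 0#

  Span : ∀ {n k} → Vector (Coord n) k → Pred (Coord n) (c ⊔ ℓ)
  Span b x = ∃[ s ] (x ≋ linComb s b)

  IsBasis : ∀ {n k} → Subspace n → Vector (Coord n) k → Set (c ⊔ ℓ)
  IsBasis U b =
    LinearlyIndependent b × (∀ j → b j ∈ ⟦ U ⟧) × ⟦ U ⟧ ⊆ Span b

  -- dim U = k.  Dimension, and the distances derived from it, are given by
  -- their graphs.
  HasDim : ∀ {n} → Subspace n → ℕ → Set (c ⊔ ℓ)
  HasDim {n} U k = Σ (Vector (Coord n) k) (IsBasis U)

  -- d_I(U,V) = δ; it requires U and V to have a common dimension.
  InjectionDistance : ∀ {n} → Subspace n → Subspace n → ℤ → Set (c ⊔ ℓ)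
  InjectionDistance U V δ =
    ∃[ k ] ∃[ m ] HasDim U k × HasDim V k × HasDim (U ⊓ V) m ×
      δ ≡ + k ℤ.- + m

  -- The index i : Fin (n ∸ 1) stands for the position toℕ i + 1.
  record Flag (n : ℕ) : Set (lsuc (c ⊔ ℓ)) where
    field
      space : Fin (n ∸ 1) → Subspace n
      chain : ∀ {i j} → i Fin.< j → ⟦ space i ⟧ ⊂ ⟦ space j ⟧
      dim   : ∀ i → HasDim (space i) (suc (toℕ i))

  open Flag public using (space)

  DistanceVector : ∀ {n} → Flag n → Flag n → Vec ℤ (n ∸ 1) → Set (c ⊔ ℓ)
  DistanceVector F F′ v =
    ∀ i → InjectionDistance (space F i) (space F′ i) (Vec.lookup v i)

  sumℤ : ∀ {m} → Vec ℤ m → ℤ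
  sumℤ = Vec.foldr (λ _ → ℤ) ℤ._+_ (+ 0)

  FlagDistance : ∀ {n} → Flag n → Flag n → ℤ → Set (c ⊔ ℓ)
  FlagDistance F F′ δ = ∃[ v ] DistanceVector F F′ v × sumℤ v ≡ δ

  -- 𝒟 d n is the set written 𝒟(d,n).
  𝒟 : ℕ → (n : ℕ) → Pred (Vec ℤ (n ∸ 1)) (lsuc (c ⊔ ℓ))
  𝒟 d n v =
    Σ (Flag n) λ F → Σ (Flag n) λ F′ →
      DistanceVector F F′ v × FlagDistance F F′ (+ d)

------------------------------------------------------------------------
-- Motzkin paths

data Step : Set where
  U D H : Step

rise : Step → ℤ
rise U = + 1
rise D = ℤ.- + 1
rise H = + 0

-- Every step has horizontal length 1, so a path is determined by the
-- heights of its vertices over 0, 1, …, n.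
heightsFrom : ∀ {n} → ℤ → Vec Step n → Vec ℤ (suc n)
heightsFrom h []      = h ∷ []
heightsFrom h (s ∷ w) = h ∷ heightsFrom (h ℤ.+ rise s) w

heights : ∀ {n} → Vec Step n → Vec ℤ (suc n)
heights = heightsFrom (+ 0)

IsMotzkin : ∀ {n} → Vec Step n → Set
IsMotzkin w = All (+ 0 ℤ.≤_) (heights w) × Vec.last (heights w) ≡ + 0

isMotzkin? : ∀ {n} (w : Vec Step n) → Dec (IsMotzkin w)
isMotzkin? w =
  All.all? (+ 0 ℤ.≤?_) (heights w) ×-dec (Vec.last (heights w) ℤ.≟ + 0)

-- Sum of the areas of the trapezoids between consecutive vertices.
areaBelow : ∀ {n} → Vec ℤ (suc n) → ℚ
areaBelow (h ∷ [])          = ℚ.0ℚ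
areaBelow (h ∷ hs@(h′ ∷ _)) = (h ℤ.+ h′) ℚ./ 2 ℚ.+ areaBelow hs

area : ∀ {n} → Vec Step n → ℚ
area w = areaBelow (heights w)

allWords : ∀ n → List (Vec Step n)
allWords zero    = List.[ [] ]
allWords (suc n) =
  List.cartesianProductWith _∷_ (U List.∷ D List.∷ H List.∷ List.[]) (allWords n)

T : ℕ → ℕ → ℕ
T n k = List.length (List.filter
  (λ w → isMotzkin? w ×-dec (area w ℚ.≟ (+ k) ℚ./ 1)) (allWords n))

{-# OPTIONS --safe #-}

-- The distance vector v of two flags, extended by v₀ = vₙ = 0, satisfies
-- |vᵢ₊₁ − vᵢ| ≤ 1: passing from 𝓕ᵢ ∩ 𝓕′ᵢ to 𝓕ᵢ₊₁ ∩ 𝓕′ᵢ₊₁ enlarges the dimension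
-- by 0, 1 or 2, because each of the two flags imposes one linear condition.
-- So v is the sequence of inner heights of a Motzkin path, whose area is Σ vᵢ.
--
-- Conversely, read a Motzkin path as instructions for building two flags of
-- coordinate subspaces: U adds one fresh coordinate to the left space and
-- another one to the right space, H adds a fresh coordinate to both, and D adds
-- to each space a coordinate so far belonging to the other space only.  The
-- height is then the number of coordinates in the left space only, which is the
-- injection distance.

module Submission where

open import Defs hiding (U; D; H)
open import Data.Nat using (ℕ; _≤_; _^_; _/_)

import Algebra.Properties.AbelianGroup as AbelianGroupProperties
import Algebra.Properties.CommutativeSemigroup as CommutativeSemigroupProperties
open import Data.Bool.Base using (Bool; true; false)
import Data.Bool.Properties as Bool
open import Data.Fin.Base as Fin
  using (Fin; zero; suc; toℕ; fromℕ; inject₁; punchIn; finToFun; funToFin)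
import Data.Fin.Properties as Fin
open import Data.Integer.Base as ℤ using (ℤ; +_)
import Data.Integer.Properties as ℤ
open import Data.Integer.Tactic.RingSolver using (solve-∀)
open import Data.List.Base as List using (List)
import Data.List.Membership.Propositional as List
open import Data.List.Membership.Propositional.Properties
  using (∈-filter⁺; ∈-filter⁻; ∈-cartesianProductWith⁺; ∈-lookup)
open import Data.List.Relation.Unary.All as ListAll using ([]; _∷_)
open import Data.List.Relation.Unary.AllPairs using ([]; _∷_)
open import Data.List.Relation.Unary.Any as Any using (here; there)
open import Data.List.Relation.Unary.Any.Properties using (lookup-index)
open import Data.List.Relation.Unary.Unique.Propositional using (Unique)
import Data.List.Relation.Unary.Unique.Propositional.Properties as Unique
open import Data.Nat.Base as ℕ using (zero; suc; z≤n; s≤s)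
import Data.Nat.Properties as ℕ
open import Data.Product.Base using (Σ; ∃-syntax; _×_; _,_; proj₁; proj₂)
import Data.Product.Properties as Product
import Data.Rational.Base as ℚ
import Data.Rational.Properties as ℚ
open import Data.Rational.Unnormalised.Base as ℚᵘ using (mkℚᵘ; *≡*; _≃_)
import Data.Rational.Unnormalised.Properties as ℚᵘ
open import Data.Unit.Base using (tt)
open import Data.Vec.Base as Vec using (Vec; []; _∷_)
open import Data.Vec.Functional as F using (Vector; insertAt)
open import Data.Vec.Functional.Properties using (insertAt-lookup; insertAt-punchIn)
import Data.Vec.Properties as Vec
open import Data.Vec.Relation.Unary.All using (All; []; _∷_)
open import Function.Base using (_∘_; id; case_of_)
open import Function.Bundles using (Inverse)
open import Level using (Level; Lift; lift; lower; _⊔_)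
open import Relation.Binary.Definitions using (Decidable)
open import Relation.Binary.PropositionalEquality as ≡ using (_≡_)
open import Relation.Nullary.Decidable as Dec using (Dec; does; yes; no; ¬?; _×-dec_)
open import Relation.Nullary.Negation using (¬_; contradiction)
open import Relation.Unary using (Pred; _∈_; _⊆_)

private
  variable
    n k m r : ℕ

-- Counting the entries that pass a Boolean test

iverson : Bool → ℕ
iverson true  = 1
iverson false = 0

count : ∀ {a} {A : Set a} {n} → (A → Bool) → Vec A n → ℕ
count P []       = 0
count P (a ∷ as) = iverson (P a) ℕ.+ count P as

-- Linear algebra

module LinearAlgebra {c ℓ q} (𝔽 : FiniteField c ℓ q) where
  open FiniteField 𝔽 hiding (zero)
  open Flags 𝔽
  open import Algebra.Properties.Semiring.Sum semiring
  open import Algebra.Properties.Ring ring using (-‿distribˡ-*; -‿distribʳ-*; +-inverseˡ-unique)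
  open import Algebra.Properties.CommutativeSemigroup +-commutativeSemigroup using (interchange)
  open import Relation.Binary.Reasoning.Setoid setoid

  private
    module Card = Inverse cardinality

  infix 4 _≟_
  -- Elements are compared through their indices in `Fin q`: finiteness makes the equality of the
  -- field decidable.
  _≟_ : Decidable _≈_
  x ≟ y = Dec.map′
    (λ eq → trans (sym (Card.strictlyInverseˡ x)) (trans (Card.to-cong eq) (Card.strictlyInverseˡ y)))
    Card.from-cong (Card.from x Fin.≟ Card.from y)

  linComb-cong : ∀ {s t : Vector Carrier k} (b : Vector (Coord n) k) →
                 (∀ j → s j ≈ t j) → linComb s b ≋ linComb t b
  linComb-cong b s≈t i = sum-cong-≋ (λ j → *-congʳ (s≈t j))

  linComb-0 : ∀ (b : Vector (Coord n) k) → linComb (λ _ → 0#) b ≋ 0ᵥ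
  linComb-0 {k = k} b i = trans (sum-cong-≋ (λ j → zeroˡ (b j i))) (sum-replicate-zero k)

  linComb-+ : ∀ (s t : Vector Carrier k) (b : Vector (Coord n) k) →
              linComb (λ j → s j + t j) b ≋ linComb s b +ᵥ linComb t b
  linComb-+ s t b i =
    trans (sum-cong-≋ (λ j → distribʳ (b j i) (s j) (t j)))
      (∑-distrib-+ (λ j → s j * b j i) (λ j → t j * b j i))

  linComb-* : ∀ r (s : Vector Carrier k) (b : Vector (Coord n) k) →
              linComb (λ j → r * s j) b ≋ r *ᵥ linComb s b
  linComb-* r s b i =
    trans (sum-cong-≋ (λ j → *-assoc r (s j) (b j i))) (sym (*-distribˡ-sum r (λ j → s j * b j i)))

  linComb-∈ : ∀ (U : Subspace n) {b : Vector (Coord n) k} → (∀ j → b j ∈ ⟦ U ⟧) →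
              ∀ s → linComb s b ∈ ⟦ U ⟧
  linComb-∈ {k = zero}  U b∈U s = Subspace.0-closed U
  linComb-∈ {k = suc k} U b∈U s = Subspace.+-closed U
    (Subspace.*-closed U (s zero) (b∈U zero)) (linComb-∈ U (b∈U ∘ suc) (s ∘ suc))

  span : Vector (Coord n) k → Subspace n
  span b = record
    { ⟦_⟧      = Span b
    ; resp     = λ x≋y (s , x≋s) → s , λ i → trans (sym (x≋y i)) (x≋s i)
    ; 0-closed = (λ _ → 0#) , λ i → sym (linComb-0 b i)
    ; +-closed = λ (s , x≋s) (t , y≋t) → (λ j → s j + t j) ,
        λ i → trans (+-cong (x≋s i) (y≋t i)) (sym (linComb-+ s t b i))
    ; *-closed = λ r (s , x≋s) → (λ j → r * s j) ,
        λ i → trans (*-congˡ (x≋s i)) (sym (linComb-* r s b i))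
    }

  -- Exhaustive search: up to `_≈_` there are finitely many coefficient vectors, and `finToFun` runs
  -- through all of them.
  span? : ∀ (b : Vector (Coord n) k) x → Dec (x ∈ Span b)
  span? b x = Dec.map′
    (λ (i , x≋) → Card.to ∘ finToFun i , x≋)
    (λ (s , x≋s) → funToFin (Card.from ∘ s) , λ i → trans (x≋s i)
      (linComb-cong b (λ j → trans (sym (Card.strictlyInverseˡ (s j)))
        (reflexive (≡.cong Card.to (≡.sym (Fin.finToFun-funToFin (Card.from ∘ s) j))))) i))
    (Fin.any? (λ i → Fin.all? (λ j → x j ≟ linComb (Card.to ∘ finToFun i) b j)))

  -- A relation with a nonzero coefficient at `x` could be divided by that coefficient, which would
  -- put `x` into the span of `b`.
  independent-∷ : ∀ x (b : Vector (Coord n) k) → LinearlyIndependent b → ¬ (x ∈ Span b) →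
                  LinearlyIndependent (x F.∷ b)
  independent-∷ x b indep x∉b s s≋0 with s zero ≟ 0#
  ... | yes s₀≈0 = λ where
          zero    → s₀≈0
          (suc j) → indep (s ∘ suc) (λ i → begin
            linComb (s ∘ suc) b i                    ≈⟨ +-identityˡ _ ⟨
            0# + linComb (s ∘ suc) b i               ≈⟨ +-congʳ (trans (*-congʳ s₀≈0) (zeroˡ (x i))) ⟨
            s zero * x i + linComb (s ∘ suc) b i     ≈⟨ s≋0 i ⟩
            0#                                       ∎) j
  ... | no s₀≉0 with y , s₀y≈1 ← inverse (s zero) s₀≉0 =
    contradiction ((λ j → - y * s (suc j)) , λ i → begin
      x i                                 ≈⟨ *-identityˡ (x i) ⟨
      1# * x i                            ≈⟨ *-congʳ (trans (*-comm y (s zero)) s₀y≈1) ⟨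
      y * s zero * x i                    ≈⟨ *-assoc y (s zero) (x i) ⟩
      y * (s zero * x i)                  ≈⟨ *-congˡ (+-inverseˡ-unique _ _ (s≋0 i)) ⟩
      y * - linComb (s ∘ suc) b i         ≈⟨ -‿distribʳ-* y _ ⟨
      - (y * linComb (s ∘ suc) b i)       ≈⟨ -‿distribˡ-* y _ ⟩
      - y * linComb (s ∘ suc) b i         ≈⟨ linComb-* (- y) (s ∘ suc) b i ⟨
      linComb (λ j → - y * s (suc j)) b i ∎) x∉b

  -- Gaussian elimination of the single vector e: if some w p has a nonzero
  -- e-coefficient, subtract multiples of w p from the other vectors.
  eliminate : ∀ (U : Subspace n) e {w : Vector (Coord n) (suc r)} → LinearlyIndependent w →
    (∀ j → ∃[ α ] ∃[ u ] u ∈ ⟦ U ⟧ × w j ≋ α *ᵥ e +ᵥ u) →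
    ∃[ w′ ] LinearlyIndependent {k = r} w′ × (∀ j → w′ j ∈ ⟦ U ⟧) ×
      (∀ (W : Subspace n) → (∀ j → w j ∈ ⟦ W ⟧) → ∀ j → w′ j ∈ ⟦ W ⟧)
  eliminate {r = r} U e {w} indep dec with Fin.any? (λ j → ¬? (proj₁ (dec j) ≟ 0#))
  -- Every `w j` already lies in `U`, so any one of them may be dropped to reach length `r`.
  ... | no all0 = w ∘ suc , tail-indep , (λ j → w∈U (suc j)) , λ W w∈W j → w∈W (suc j)
    where
    tail-indep : LinearlyIndependent (w ∘ suc)
    tail-indep s s≋0 j = indep (0# F.∷ s)
      (λ i → trans (+-cong (zeroˡ (w zero i)) (s≋0 i)) (+-identityˡ 0#)) (suc j)
    w∈U : ∀ j → w j ∈ ⟦ U ⟧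
    w∈U j with dec j in eq
    ... | α , u , u∈U , w≋ with α ≟ 0#
    ...   | yes α≈0 = Subspace.resp U (λ i → sym (begin
              w j i           ≈⟨ w≋ i ⟩
              α * e i + u i   ≈⟨ +-congʳ (trans (*-congʳ α≈0) (zeroˡ (e i))) ⟩
              0# + u i        ≈⟨ +-identityˡ (u i) ⟩
              u i             ∎)) u∈U
    ...   | no α≉0 = contradiction
              (j , ≡.subst (λ d → ¬ (proj₁ d ≈ 0#)) (≡.sym eq) α≉0) all0
  ... | yes (p , αp≉0) with β , αpβ≈1 ← inverse (proj₁ (dec p)) αp≉0 =
    w′ , w′-indep , w′∈U ,
    λ W w∈W j → Subspace.+-closed W (w∈W (punchIn p j)) (Subspace.*-closed W (t j) (w∈W p))
    where
    α : Fin (suc r) → Carrier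
    α j = proj₁ (dec j)
    u : Vector (Coord _) (suc r)
    u j = proj₁ (proj₂ (dec j))
    u∈U : ∀ j → u j ∈ ⟦ U ⟧
    u∈U j = proj₁ (proj₂ (proj₂ (dec j)))
    w≋ : ∀ j → w j ≋ α j *ᵥ e +ᵥ u j
    w≋ j = proj₂ (proj₂ (proj₂ (dec j)))
    -- With `β` inverse to `α p`, this multiple of `w p` cancels the `e`-coefficient of the `j`-th
    -- remaining vector.
    t : Fin r → Carrier
    t j = - (α (punchIn p j) * β)
    w′ : Vector (Coord _) r
    w′ j = w (punchIn p j) +ᵥ t j *ᵥ w p
    αp+tα≈0 : ∀ j → α (punchIn p j) + t j * α p ≈ 0#
    αp+tα≈0 j = begin
      α′ + - (α′ * β) * α p     ≈⟨ +-congˡ (-‿distribˡ-* (α′ * β) (α p)) ⟨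
      α′ + - (α′ * β * α p)     ≈⟨ +-congˡ (-‿cong (*-assoc α′ β (α p))) ⟩
      α′ + - (α′ * (β * α p))   ≈⟨ +-congˡ (-‿cong (*-congˡ (trans (*-comm β (α p)) αpβ≈1))) ⟩
      α′ + - (α′ * 1#)          ≈⟨ +-congˡ (-‿cong (*-identityʳ α′)) ⟩
      α′ + - α′                 ≈⟨ -‿inverseʳ α′ ⟩
      0#                      ∎
      where α′ = α (punchIn p j)
    w′∈U : ∀ j → w′ j ∈ ⟦ U ⟧
    w′∈U j = Subspace.resp U (λ i → sym (begin
      w j′ i + t j * w p i
        ≈⟨ +-cong (w≋ j′ i) (*-congˡ (w≋ p i)) ⟩
      (α j′ * e i + u j′ i) + t j * (α p * e i + u p i)
        ≈⟨ +-congˡ (distribˡ (t j) _ _) ⟩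
      (α j′ * e i + u j′ i) + (t j * (α p * e i) + t j * u p i)
        ≈⟨ interchange _ _ _ _ ⟩
      (α j′ * e i + t j * (α p * e i)) + (u j′ i + t j * u p i)
        ≈⟨ +-congʳ (+-congˡ (*-assoc (t j) (α p) (e i))) ⟨
      (α j′ * e i + t j * α p * e i) + (u j′ i + t j * u p i)
        ≈⟨ +-congʳ (distribʳ (e i) _ _) ⟨
      (α j′ + t j * α p) * e i + (u j′ i + t j * u p i)
        ≈⟨ +-congʳ (trans (*-congʳ (αp+tα≈0 j)) (zeroˡ (e i))) ⟩
      0# + (u j′ i + t j * u p i)
        ≈⟨ +-identityˡ _ ⟩
      u j′ i + t j * u p i ∎))
      (Subspace.+-closed U (u∈U j′) (Subspace.*-closed U (t j) (u∈U p)))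
      where j′ = punchIn p j
    w′-indep : LinearlyIndependent w′
    w′-indep s s≋0 j = begin
      s j                               ≡⟨ insertAt-punchIn s p S j ⟨
      insertAt s p S (punchIn p j)      ≈⟨ indep (insertAt s p S) s′≋0 (punchIn p j) ⟩
      0#                                ∎
      where
      -- The total coefficient of `w p` in a combination of the `w′ j`; inserting it at `p` turns a
      -- relation among the `w′ j` into one among the `w j`.
      S : Carrier
      S = sum (λ j → s j * t j)
      s′≋0 : linComb (insertAt s p S) w ≋ 0ᵥ
      s′≋0 i = begin
        linComb (insertAt s p S) w i
          ≈⟨ sum-remove {i = p} (λ j → insertAt s p S j * w j i) ⟩
        insertAt s p S p * w p i + sum (λ j → insertAt s p S (punchIn p j) * w (punchIn p j) i)
          ≈⟨ +-cong (*-congʳ (reflexive (insertAt-lookup s p S)))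
               (sum-cong-≋ (λ j → *-congʳ (reflexive (insertAt-punchIn s p S j)))) ⟩
        S * w p i + sum (λ j → s j * w (punchIn p j) i)
          ≈⟨ +-comm _ _ ⟩
        sum (λ j → s j * w (punchIn p j) i) + S * w p i
          ≈⟨ +-congˡ (*-distribʳ-sum (w p i) (λ j → s j * t j)) ⟩
        sum (λ j → s j * w (punchIn p j) i) + sum (λ j → s j * t j * w p i)
          ≈⟨ +-congˡ (sum-cong-≋ (λ j → *-assoc (s j) (t j) (w p i))) ⟩
        sum (λ j → s j * w (punchIn p j) i) + sum (λ j → s j * (t j * w p i))
          ≈⟨ ∑-distrib-+ (λ j → s j * w (punchIn p j) i) (λ j → s j * (t j * w p i)) ⟨
        sum (λ j → s j * w (punchIn p j) i + s j * (t j * w p i))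
          ≈⟨ sum-cong-≋ (λ j → distribˡ (s j) (w (punchIn p j) i) (t j * w p i)) ⟨
        linComb s w′ i
          ≈⟨ s≋0 i ⟩
        0# ∎

  -- Induction on `m`: eliminating `b′ zero` costs one vector of `b` and leaves `k` independent
  -- vectors in the span of the tail of `b′`. If `b′` is empty, `b zero` is the zero vector, and the
  -- relation with coefficient `1#` contradicts `0≉1`.
  steinitz : ∀ (b : Vector (Coord n) k) (b′ : Vector (Coord n) m) →
             LinearlyIndependent b → (∀ j → b j ∈ Span b′) → k ≤ m
  steinitz {k = zero} b b′ indep b∈b′ = z≤n
  steinitz {k = suc k} {m = zero} b b′ indep b∈b′ =
    contradiction (sym (indep (1# F.∷ λ _ → 0#) combination zero)) 0≉1
    where
    combination : linComb (1# F.∷ λ _ → 0#) b ≋ 0ᵥ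
    combination i = begin
      1# * b zero i + linComb (λ _ → 0#) (b ∘ suc) i
        ≈⟨ +-cong (*-identityˡ _) (linComb-0 (b ∘ suc) i) ⟩
      b zero i + 0#  ≈⟨ +-identityʳ _ ⟩
      b zero i       ≈⟨ proj₂ (b∈b′ zero) i ⟩
      0#             ∎
  steinitz {k = suc k} {m = suc m} b b′ indep b∈b′
    with w′ , w′-indep , w′∈ , _ ← eliminate (span (b′ ∘ suc)) (b′ zero) indep
      (λ j → let s , bj≋ = b∈b′ j in
        s zero , linComb (s ∘ suc) (b′ ∘ suc) , (s ∘ suc , λ i → refl) , bj≋)
    = s≤s (steinitz w′ (b′ ∘ suc) w′-indep w′∈)

  HasDim-mono : ∀ {U V : Subspace n} → ⟦ U ⟧ ⊆ ⟦ V ⟧ → HasDim U k → HasDim V m → k ≤ m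
  HasDim-mono U⊆V (b , indep , b∈U , _) (b′ , _ , _ , V⊆b′) =
    steinitz b b′ indep (λ j → V⊆b′ (U⊆V (b∈U j)))

  HasDim-unique : ∀ {U : Subspace n} → HasDim U k → HasDim U m → k ≡ m
  HasDim-unique {U = U} d d′ =
    ℕ.≤-antisym (HasDim-mono {U = U} {U} id d d′) (HasDim-mono {U = U} {U} id d′ d)

  HasDim-resp : ∀ {U V : Subspace n} → ⟦ U ⟧ ⊆ ⟦ V ⟧ → ⟦ V ⟧ ⊆ ⟦ U ⟧ → HasDim U k → HasDim V k
  HasDim-resp U⊆V V⊆U (b , indep , b∈U , U⊆b) = b , indep , (λ j → U⊆V (b∈U j)) , λ x∈V → U⊆b (V⊆U x∈V)

  -- For `e` serves a basis vector of `U′` outside `U`; one exists because `k + 1` independent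
  -- vectors do not fit into `U`. Together with `b` it spans `U′`, since a vector of `U′` outside
  -- this span would give `k + 2` independent vectors in `U′`. Both case distinctions rest on
  -- `span?`.
  complement : ∀ {U U′ : Subspace n} → ⟦ U ⟧ ⊆ ⟦ U′ ⟧ → HasDim U k → HasDim U′ (suc k) →
    ∃[ e ] ∀ {x} → x ∈ ⟦ U′ ⟧ → ∃[ α ] ∃[ u ] u ∈ ⟦ U ⟧ × x ≋ α *ᵥ e +ᵥ u
  complement {k = k} {U} {U′} U⊆U′ (b , indep , b∈U , _) (b′ , indep′ , b′∈U′ , U′⊆b′)
    with Fin.any? (λ j → ¬? (span? b (b′ j)))
  ... | no none = contradiction
          (steinitz b′ b indep′ (λ j → Dec.decidable-stable (span? b (b′ j)) (λ ∉ → none (j , ∉))))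
          (ℕ.n≮n k)
  ... | yes (j , ∉) = b′ j , λ {x} x∈U′ → case span? (b′ j F.∷ b) x of λ where
          (yes (s , x≋)) → s zero , linComb (s ∘ suc) b , linComb-∈ U b∈U (s ∘ suc) , x≋
          (no x∉) → contradiction
            (steinitz (x F.∷ b′ j F.∷ b) b′ (independent-∷ x (b′ j F.∷ b) (independent-∷ (b′ j) b indep ∉) x∉) (λ where
              zero          → U′⊆b′ x∈U′
              (suc zero)    → U′⊆b′ (b′∈U′ j)
              (suc (suc i)) → U′⊆b′ (U⊆U′ (b∈U i))))
            (ℕ.n≮n (suc k))

  -- Passing to a hyperplane costs at most one vector. The last component records that the new
  -- vectors stay in every subspace containing the old ones, so that the lemma can be applied to two
  -- hyperplanes in turn.
  independent-in-hyperplane : ∀ {U U′ : Subspace n} → ⟦ U ⟧ ⊆ ⟦ U′ ⟧ →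
    HasDim U k → HasDim U′ (suc k) →
    ∀ {w : Vector (Coord n) (suc r)} → LinearlyIndependent w → (∀ j → w j ∈ ⟦ U′ ⟧) →
    ∃[ w′ ] LinearlyIndependent {k = r} w′ × (∀ j → w′ j ∈ ⟦ U ⟧) ×
      (∀ (W : Subspace n) → (∀ j → w j ∈ ⟦ W ⟧) → ∀ j → w′ j ∈ ⟦ W ⟧)
  independent-in-hyperplane {U = U} {U′} U⊆U′ dimU dimU′ indep w∈U′
    with e , decompose ← complement {U = U} {U′} U⊆U′ dimU dimU′
    = eliminate U e indep (λ j → decompose (w∈U′ j))

  -- A basis of `U′ ⊓ V′` is first moved into `U`, where it stays inside `V′`, and then into `V`,
  -- where it stays inside `U`. Two vectors are lost, and the others are independent in `U ⊓ V`.
  HasDim-⊓-hyperplanes : ∀ {k₁ k₂} {U U′ V V′ : Subspace n} →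
    ⟦ U ⟧ ⊆ ⟦ U′ ⟧ → HasDim U k₁ → HasDim U′ (suc k₁) →
    ⟦ V ⟧ ⊆ ⟦ V′ ⟧ → HasDim V k₂ → HasDim V′ (suc k₂) →
    HasDim (U ⊓ V) m → HasDim (U′ ⊓ V′) r → r ≤ 2 ℕ.+ m
  HasDim-⊓-hyperplanes {r = zero}        _ _ _ _ _ _ _ _ = z≤n
  HasDim-⊓-hyperplanes {r = suc zero}    _ _ _ _ _ _ _ _ = s≤s z≤n
  HasDim-⊓-hyperplanes {r = suc (suc r)} {U = U} {U′} {V} {V′}
    U⊆U′ dimU dimU′ V⊆V′ dimV dimV′ (b , _ , _ , U⊓V⊆b) (w , indep , w∈ , _)
    with x , x-indep , x∈U , x∈ ← independent-in-hyperplane {U = U} {U′} U⊆U′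
           dimU dimU′ indep (λ j → proj₁ (w∈ j))
    with y , y-indep , y∈V , y∈ ← independent-in-hyperplane {U = V} {V′} V⊆V′
           dimV dimV′ x-indep (x∈ V′ (λ j → proj₂ (w∈ j)))
    = s≤s (s≤s (steinitz y b y-indep (λ j → U⊓V⊆b (y∈ U x∈U j , y∈V j))))

  -- The span of the unit vectors at the coordinates whose label passes `P`, given by the vanishing
  -- of all other coordinates. Keeping labels and test apart lets one labelling describe the left
  -- space, the right space and their intersection.
  coordinateSpace : ∀ {A : Set} → (A → Bool) → Vec A n → Subspace n
  coordinateSpace P as = record
    { ⟦_⟧      = λ x → ∀ i → P (Vec.lookup as i) ≡ false → Lift (c ⊔ ℓ) (x i ≈ 0#)
    ; resp     = λ x≋y x∈ i out → lift (trans (sym (x≋y i)) (lower (x∈ i out)))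
    ; 0-closed = λ i out → lift refl
    ; +-closed = λ x∈ y∈ i out →
        lift (trans (+-cong (lower (x∈ i out)) (lower (y∈ i out))) (+-identityˡ 0#))
    ; *-closed = λ s x∈ i out → lift (trans (*-congˡ (lower (x∈ i out))) (zeroʳ s))
    }

  private
    linComb-const0 : ∀ (s : Vector Carrier k) → sum (λ j → s j * 0#) ≈ 0#
    linComb-const0 {k = k} s = trans (sum-cong-≋ (λ j → zeroʳ (s j))) (sum-replicate-zero k)

  -- The basis consists of the selected unit vectors: a new first coordinate extends the old ones by
  -- `0#` and, if selected, contributes its own unit vector.
  HasDim-coordinateSpace : ∀ {A : Set} (P : A → Bool) (as : Vec A n) →
                           HasDim (coordinateSpace P as) (count P as)
  HasDim-coordinateSpace P [] = (λ ()) , (λ _ _ ()) , (λ ()) , λ _ → (λ ()) , λ ()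
  HasDim-coordinateSpace {n = suc n} P (a ∷ as)
    with P a in Pa | HasDim-coordinateSpace P as
  ... | false | b , indep , b∈ , ⊆b =
    (λ j → 0# F.∷ b j) ,
    (λ s s≋0 → indep s (λ i → s≋0 (suc i))) ,
    (λ j → λ where
      zero    out → lift refl
      (suc i) out → b∈ j i out) ,
    λ x∈ → let s , x≋ = ⊆b (λ i → x∈ (suc i)) in s , λ where
      zero    → trans (lower (x∈ zero Pa)) (sym (linComb-const0 s))
      (suc i) → x≋ i
  ... | true | b , indep , b∈ , ⊆b = b⁺ , indep⁺ , b⁺∈ , ⊆b⁺
    where
    b⁺ : Vector (Coord (suc n)) (suc (count P as))
    b⁺ = (1# F.∷ 0ᵥ) F.∷ λ j → 0# F.∷ b j
    linComb-zero : ∀ s → linComb s b⁺ zero ≈ s zero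
    linComb-zero s = begin
      s zero * 1# + sum (λ j → s (suc j) * 0#) ≈⟨ +-cong (*-identityʳ _) (linComb-const0 (s ∘ suc)) ⟩
      s zero + 0#                              ≈⟨ +-identityʳ _ ⟩
      s zero                                   ∎
    linComb-suc : ∀ s i → linComb s b⁺ (suc i) ≈ linComb (s ∘ suc) b i
    linComb-suc s i = trans (+-congʳ (zeroʳ (s zero))) (+-identityˡ _)
    indep⁺ : LinearlyIndependent b⁺
    indep⁺ s s≋0 zero    = trans (sym (linComb-zero s)) (s≋0 zero)
    indep⁺ s s≋0 (suc j) =
      indep (s ∘ suc) (λ i → trans (sym (linComb-suc s i)) (s≋0 (suc i))) j
    b⁺∈ : ∀ j → b⁺ j ∈ ⟦ coordinateSpace P (a ∷ as) ⟧
    b⁺∈ zero    zero    out = contradiction (≡.trans (≡.sym Pa) out) λ ()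
    b⁺∈ zero    (suc i) out = lift refl
    b⁺∈ (suc j) zero    out = lift refl
    b⁺∈ (suc j) (suc i) out = b∈ j i out
    ⊆b⁺ : ⟦ coordinateSpace P (a ∷ as) ⟧ ⊆ Span b⁺
    ⊆b⁺ {x} x∈ with s , x≋ ← ⊆b (λ i → x∈ (suc i)) = x zero F.∷ s , λ where
      zero    → sym (linComb-zero (x zero F.∷ s))
      (suc i) → trans (x≋ i) (sym (linComb-suc (x zero F.∷ s) i))

-- Cardinality of an enumerated subset

open ≡ using (refl; sym; trans; cong; cong₂; subst; module ≡-Reasoning)
open CommutativeSemigroupProperties ℕ.+-commutativeSemigroup using (x∙yz≈y∙xz; interchange)
open AbelianGroupProperties ℤ.+-0-abelianGroup using () renaming (∙-cancelˡ to +-cancelˡ-≡)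

private
  variable
    a p : Level
    A : Set a
    h h′ i : ℕ

-- Since `subset` ignores membership proofs, the inverse laws are plain equations in `A`.
HasCardinality-enumeration : ∀ {P : Pred A p} {N} (f : Fin N → A) →
  (∀ i → f i ∈ P) → (∀ {i j} → f i ≡ f j → i ≡ j) →
  (∀ {x} → x ∈ P → ∃[ i ] f i ≡ x) → HasCardinality (subset P) N
HasCardinality-enumeration f f∈P injective surjective = record
  { to        = λ i → f i , f∈P i
  ; from      = λ (x , x∈P) → proj₁ (surjective x∈P)
  ; to-cong   = cong f
  ; from-cong = λ {(x , x∈P)} {(y , y∈P)} x≡y → injective
      (trans (proj₂ (surjective x∈P)) (trans x≡y (sym (proj₂ (surjective y∈P)))))
  ; inverse   = (λ {(x , x∈P)} i≡ → trans (cong f i≡) (proj₂ (surjective x∈P)))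
              , λ {i} {(x , x∈P)} x≡ → injective (trans (proj₂ (surjective x∈P)) x≡)
  }

lookup-injective : ∀ {xs : List A} → Unique xs → ∀ {i j} →
                   List.lookup xs i ≡ List.lookup xs j → i ≡ j
lookup-injective (_ ∷ _) {zero} {zero} _ = refl
lookup-injective {xs = x List.∷ xs} (x∉ ∷ _) {zero} {suc j} eq =
  contradiction eq (ListAll.lookup x∉ (∈-lookup j))
lookup-injective {xs = x List.∷ xs} (x∉ ∷ _) {suc i} {zero} eq =
  contradiction (sym eq) (ListAll.lookup x∉ (∈-lookup i))
lookup-injective (_ ∷ u) {suc i} {suc j} eq = cong suc (lookup-injective u eq)

-- Motzkin paths

infix 4 _⇝_
-- The three Motzkin steps on natural heights; that a path never runs below the axis is built into
-- the type.
data _⇝_ : ℕ → ℕ → Set where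
  up    : h ⇝ suc h
  down  : suc h ⇝ h
  level : h ⇝ h

-- v lists the heights strictly between the initial height h and the final
-- height 0.
Path : ℕ → Vec ℕ k → Set
Path h []      = h ⇝ 0
Path h (x ∷ v) = h ⇝ x × Path x v

⇝⇒≤ : h ⇝ h′ → h ≤ suc h′
⇝⇒≤ up    = ℕ.m≤n⇒m≤1+n (ℕ.n≤1+n _)
⇝⇒≤ down  = ℕ.≤-refl
⇝⇒≤ level = ℕ.n≤1+n _

-- Each of the remaining `k + 1` steps descends by at most one. This bound guarantees enough fresh
-- coordinates when the flags are built.
Path⇒≤ : ∀ (v : Vec ℕ k) → Path h v → h ≤ suc k
Path⇒≤ []      s       = ⇝⇒≤ s
Path⇒≤ (x ∷ v) (s , p) = ℕ.≤-trans (⇝⇒≤ s) (s≤s (Path⇒≤ v p))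

Path-tabulate : ∀ (f : Fin (suc k) → ℕ) → h ⇝ f zero →
  (∀ i → f (inject₁ i) ⇝ f (suc i)) → f (fromℕ k) ⇝ 0 → Path h (Vec.tabulate f)
Path-tabulate {zero}  f first inner final = first , final
Path-tabulate {suc k} f first inner final =
  first , Path-tabulate (f ∘ suc) (inner zero) (inner ∘ suc) final

rise⇒⇝ : ∀ h s → + 0 ℤ.≤ + h ℤ.+ rise s → ∃[ h′ ] h ⇝ h′ × + h ℤ.+ rise s ≡ + h′
rise⇒⇝ h       Step.U _ = suc h , up , cong +_ (ℕ.+-comm h 1)
rise⇒⇝ zero    Step.D ()
rise⇒⇝ (suc h) Step.D _ = h , down , refl
rise⇒⇝ h       Step.H _ = h , level , ℤ.+-identityʳ (+ h)

⇝⇒rise : h ⇝ h′ → ∃[ s ] + h ℤ.+ rise s ≡ + h′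
⇝⇒rise {h} up    = Step.U , cong +_ (ℕ.+-comm h 1)
⇝⇒rise     down  = Step.D , refl
⇝⇒rise {h} level = Step.H , ℤ.+-identityʳ (+ h)

-- The map that becomes the bijection from Motzkin paths to distance vectors. Both end vertices are
-- dropped, just as a flag omits the zero space and the whole space.
innerHeights : ℤ → Vec Step (suc k) → Vec ℤ k
innerHeights h (s ∷ [])        = []
innerHeights h (s ∷ w@(_ ∷ _)) = h ℤ.+ rise s ∷ innerHeights (h ℤ.+ rise s) w

-- An arbitrary initial height makes induction on the word possible; at `+ 0` this unfolds to
-- `IsMotzkin`.
IsMotzkinFrom : ℤ → Vec Step n → Set
IsMotzkinFrom h w = All (+ 0 ℤ.≤_) (heightsFrom h w) × Vec.last (heightsFrom h w) ≡ + 0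

last-heightsFrom-∷ : ∀ h s (w : Vec Step n) →
  Vec.last (heightsFrom h (s ∷ w)) ≡ Vec.last (heightsFrom (h ℤ.+ rise s) w)
last-heightsFrom-∷ h s []      = refl
last-heightsFrom-∷ h s (_ ∷ _) = refl

IsMotzkinFrom⇒Path : ∀ h (w : Vec Step (suc k)) → IsMotzkinFrom (+ h) w →
  ∃[ v ] Path h v × innerHeights (+ h) w ≡ Vec.map +_ v
IsMotzkinFrom⇒Path h (s ∷ []) (_ ∷ 0≤ ∷ [] , last≡0)
  with h′ , h⇝h′ , eq ← rise⇒⇝ h s 0≤
  = [] , subst (h ⇝_) (ℤ.+-injective (trans (sym eq) last≡0)) h⇝h′ , refl
IsMotzkinFrom⇒Path h (s ∷ w@(_ ∷ _)) (_ ∷ 0≤@(0≤h′ ∷ _) , last≡0)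
  with h′ , h⇝h′ , eq ← rise⇒⇝ h s 0≤h′
  with v , path , inner ← IsMotzkinFrom⇒Path h′ w (subst (λ z → IsMotzkinFrom z w) eq
         (0≤ , trans (sym (last-heightsFrom-∷ (+ h) s w)) last≡0))
  = h′ ∷ v , (h⇝h′ , path) ,
    cong₂ _∷_ eq (trans (cong (λ z → innerHeights z w) eq) inner)

Path⇒IsMotzkinFrom : ∀ (v : Vec ℕ k) → Path h v →
  ∃[ w ] IsMotzkinFrom (+ h) w × innerHeights (+ h) w ≡ Vec.map +_ v
Path⇒IsMotzkinFrom [] h⇝0 with s , eq ← ⇝⇒rise h⇝0 =
  s ∷ [] , (ℤ.+≤+ z≤n ∷ subst (+ 0 ℤ.≤_) (sym eq) ℤ.≤-refl ∷ [] , eq) , refl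
Path⇒IsMotzkinFrom {h = h} (x ∷ v) (h⇝x , path)
  with s , eq ← ⇝⇒rise h⇝x
  with w@(_ ∷ _) , motzkin , inner ← Path⇒IsMotzkinFrom v path
  with 0≤ , last≡0 ← subst (λ z → IsMotzkinFrom z w) (sym eq) motzkin
  = s ∷ w , (ℤ.+≤+ z≤n ∷ 0≤ , trans (last-heightsFrom-∷ (+ h) s w) last≡0) ,
    cong₂ _∷_ eq (trans (cong (λ z → innerHeights z w) eq) inner)

rise-injective : ∀ {s t} → rise s ≡ rise t → s ≡ t
rise-injective {Step.U} {Step.U} _ = refl
rise-injective {Step.D} {Step.D} _ = refl
rise-injective {Step.H} {Step.H} _ = refl

-- Differences of successive heights determine every step but the last, which is determined by the
-- final height.
innerHeights-injective : ∀ h (w w′ : Vec Step (suc k)) →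
  innerHeights h w ≡ innerHeights h w′ →
  Vec.last (heightsFrom h w) ≡ Vec.last (heightsFrom h w′) → w ≡ w′
innerHeights-injective h (s ∷ []) (t ∷ []) _ last≡ =
  cong (_∷ []) (rise-injective (+-cancelˡ-≡ h _ _ last≡))
innerHeights-injective h (s ∷ w@(_ ∷ _)) (t ∷ w′@(_ ∷ _)) inner≡ last≡
  with refl ← rise-injective {s} {t} (+-cancelˡ-≡ h _ _ (Vec.∷-injectiveˡ inner≡))
  = cong (s ∷_) (innerHeights-injective _ w w′ (Vec.∷-injectiveʳ inner≡)
      (trans (sym (last-heightsFrom-∷ h s w)) (trans last≡ (last-heightsFrom-∷ h t w′))))

-- The area as the sum of the inner heights

sumℤ : Vec ℤ k → ℤ
sumℤ = Vec.foldr (λ _ → ℤ) ℤ._+_ (+ 0)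

/2-+-/2 : ∀ x y → x ℚ./ 2 ℚ.+ y ℚ./ 2 ≡ (x ℤ.+ y) ℚ./ 2
/2-+-/2 x y = ℚ.toℚᵘ-injective (begin
  ℚ.toℚᵘ (x ℚ./ 2 ℚ.+ y ℚ./ 2)              ≈⟨ ℚ.toℚᵘ-homo-+ (x ℚ./ 2) (y ℚ./ 2) ⟩
  ℚ.toℚᵘ (x ℚ./ 2) ℚᵘ.+ ℚ.toℚᵘ (y ℚ./ 2)    ≈⟨ ℚᵘ.+-cong (ℚ.toℚᵘ-fromℚᵘ (mkℚᵘ x 1)) (ℚ.toℚᵘ-fromℚᵘ (mkℚᵘ y 1)) ⟩
  mkℚᵘ x 1 ℚᵘ.+ mkℚᵘ y 1                    ≈⟨ *≡* (common-denominator x y) ⟩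
  mkℚᵘ (x ℤ.+ y) 1                          ≈⟨ ℚ.toℚᵘ-fromℚᵘ (mkℚᵘ (x ℤ.+ y) 1) ⟨
  ℚ.toℚᵘ ((x ℤ.+ y) ℚ./ 2)                  ∎)
  where
  open ℚᵘ.≃-Reasoning
  -- The unnormalised sum of two halves has denominator `2 * 2`, and the equation is the
  -- cross-multiplied one.
  common-denominator : ∀ x y → (x ℤ.* + 2 ℤ.+ y ℤ.* + 2) ℤ.* + 2 ≡ (x ℤ.+ y) ℤ.* + 4
  common-denominator = solve-∀

/2≡/1⇒≡ : ∀ x y → x ℚ./ 2 ≡ y ℚ./ 1 → x ≡ + 2 ℤ.* y
/2≡/1⇒≡ x y eq = trans (sym (ℤ.*-identityʳ x)) (trans (ℚᵘ.drop-*≡* x/2≃y/1) (ℤ.*-comm y (+ 2)))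
  where
  x/2≃y/1 : mkℚᵘ x 1 ≃ mkℚᵘ y 0
  x/2≃y/1 = ℚᵘ.≃-trans (ℚᵘ.≃-sym (ℚ.toℚᵘ-fromℚᵘ (mkℚᵘ x 1)))
    (ℚᵘ.≃-trans (ℚᵘ.≃-reflexive (cong ℚ.toℚᵘ eq)) (ℚ.toℚᵘ-fromℚᵘ (mkℚᵘ y 0)))

≡⇒/2≡/1 : ∀ y → (+ 2 ℤ.* y) ℚ./ 2 ≡ y ℚ./ 1
≡⇒/2≡/1 y = ℚ.fromℚᵘ-cong {mkℚᵘ (+ 2 ℤ.* y) 1} {mkℚᵘ y 0}
  (*≡* (trans (ℤ.*-identityʳ (+ 2 ℤ.* y)) (ℤ.*-comm (+ 2) y)))

-- Trapezoid rule: an inner height belongs to two trapezoids, an end height to one. With everything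
-- over the single denominator 2, the induction step is an identity of integers.
areaBelow-heightsFrom : ∀ h (w : Vec Step (suc k)) → areaBelow (heightsFrom h w) ≡
  (h ℤ.+ Vec.last (heightsFrom h w) ℤ.+ + 2 ℤ.* sumℤ (innerHeights h w)) ℚ./ 2
areaBelow-heightsFrom h (s ∷ []) =
  trans (ℚ.+-identityʳ ((h ℤ.+ (h ℤ.+ rise s)) ℚ./ 2))
    (cong (ℚ._/ 2) (sym (ℤ.+-identityʳ (h ℤ.+ (h ℤ.+ rise s)))))
areaBelow-heightsFrom h (s ∷ w@(_ ∷ _)) = begin
  (h ℤ.+ h₁) ℚ./ 2 ℚ.+ areaBelow (heightsFrom h₁ w)
    ≡⟨ cong ((h ℤ.+ h₁) ℚ./ 2 ℚ.+_) (areaBelow-heightsFrom h₁ w) ⟩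
  (h ℤ.+ h₁) ℚ./ 2 ℚ.+ (h₁ ℤ.+ l ℤ.+ + 2 ℤ.* σ) ℚ./ 2
    ≡⟨ /2-+-/2 (h ℤ.+ h₁) (h₁ ℤ.+ l ℤ.+ + 2 ℤ.* σ) ⟩
  (h ℤ.+ h₁ ℤ.+ (h₁ ℤ.+ l ℤ.+ + 2 ℤ.* σ)) ℚ./ 2
    ≡⟨ cong (ℚ._/ 2) (regroup h h₁ l σ) ⟩
  (h ℤ.+ l ℤ.+ + 2 ℤ.* (h₁ ℤ.+ σ)) ℚ./ 2
    ≡⟨ cong (λ z → (h ℤ.+ z ℤ.+ + 2 ℤ.* (h₁ ℤ.+ σ)) ℚ./ 2) (last-heightsFrom-∷ h s w) ⟨
  (h ℤ.+ Vec.last (heightsFrom h (s ∷ w)) ℤ.+ + 2 ℤ.* (h₁ ℤ.+ σ)) ℚ./ 2 ∎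
  where
  open ≡-Reasoning
  h₁ l σ : ℤ
  h₁ = h ℤ.+ rise s
  l = Vec.last (heightsFrom h₁ w)
  σ = sumℤ (innerHeights h₁ w)
  regroup : ∀ h h₁ l σ → h ℤ.+ h₁ ℤ.+ (h₁ ℤ.+ l ℤ.+ + 2 ℤ.* σ) ≡ h ℤ.+ l ℤ.+ + 2 ℤ.* (h₁ ℤ.+ σ)
  regroup = solve-∀

area-motzkin : ∀ (w : Vec Step (suc k)) → IsMotzkin w →
               area w ≡ (+ 2 ℤ.* sumℤ (innerHeights (+ 0) w)) ℚ./ 2
area-motzkin w (_ , last≡0) = trans (areaBelow-heightsFrom (+ 0) w)
  (cong (ℚ._/ 2) (trans (cong (λ z → + 0 ℤ.+ z ℤ.+ + 2 ℤ.* sumℤ (innerHeights (+ 0) w)) last≡0)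
    (ℤ.+-identityˡ (+ 2 ℤ.* sumℤ (innerHeights (+ 0) w)))))

-- Enumeration of the Motzkin paths of given area

∈-allWords : ∀ (w : Vec Step n) → w List.∈ allWords n
∈-allWords []      = here refl
∈-allWords (s ∷ w) = ∈-cartesianProductWith⁺ _∷_ (∈-steps s) (∈-allWords w)
  where
  ∈-steps : ∀ s → s List.∈ (Step.U List.∷ Step.D List.∷ Step.H List.∷ List.[])
  ∈-steps Step.U = here refl
  ∈-steps Step.D = there (here refl)
  ∈-steps Step.H = there (there (here refl))

allWords-unique : ∀ n → Unique (allWords n)
allWords-unique zero    = [] ∷ []
allWords-unique (suc n) = Unique.cartesianProductWith⁺ _∷_ Vec.∷-injective
  (((λ ()) ∷ (λ ()) ∷ []) ∷ ((λ ()) ∷ []) ∷ [] ∷ []) (allWords-unique n)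

MotzkinOfArea : ℕ → Pred (Vec Step n) _
MotzkinOfArea d w = IsMotzkin w × area w ≡ (+ d) ℚ./ 1

-- The same decision as in `T`, so that the length of the filtered list is `T n d` by definition.
motzkinOfArea? : ∀ d (w : Vec Step n) → Dec (MotzkinOfArea d w)
motzkinOfArea? d w = isMotzkin? w ×-dec (area w ℚ.≟ (+ d) ℚ./ 1)

area⇒sum : ∀ {d} (w : Vec Step (suc k)) → IsMotzkin w → area w ≡ (+ d) ℚ./ 1 →
           sumℤ (innerHeights (+ 0) w) ≡ + d
area⇒sum {d = d} w motzkin area≡ = ℤ.*-cancelˡ-≡ (+ 2) σ (+ d)
  (/2≡/1⇒≡ (+ 2 ℤ.* σ) (+ d) (trans (sym (area-motzkin w motzkin)) area≡))
  where
  σ : ℤ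
  σ = sumℤ (innerHeights (+ 0) w)

sum⇒area : ∀ {d} (w : Vec Step (suc k)) → IsMotzkin w → sumℤ (innerHeights (+ 0) w) ≡ + d →
           area w ≡ (+ d) ℚ./ 1
sum⇒area {d = d} w motzkin sum≡ = trans (area-motzkin w motzkin)
  (trans (cong (λ z → (+ 2 ℤ.* z) ℚ./ 2) sum≡) (≡⇒/2≡/1 (+ d)))

-- The filtered list contains each good word exactly once, so its positions enumerate `P` through
-- `f`.
T-enumeration : ∀ {a p} {A : Set a} {P : Pred A p} n d (f : Vec Step n → A) →
  (∀ w → MotzkinOfArea d w → f w ∈ P) →
  (∀ {w w′} → MotzkinOfArea d w → MotzkinOfArea d w′ → f w ≡ f w′ → w ≡ w′) →
  (∀ {x} → x ∈ P → ∃[ w ] MotzkinOfArea d w × f w ≡ x) →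
  HasCardinality (subset P) (T n d)
T-enumeration n d f f∈P injective surjective = HasCardinality-enumeration
  (f ∘ word) (λ i → f∈P (word i) (word-good i))
  (λ {i} {j} eq → lookup-injective (Unique.filter⁺ (motzkinOfArea? d) {allWords n} (allWords-unique n))
    (injective (word-good i) (word-good j) eq))
  (λ x∈P → let w , good , fw≡x = surjective x∈P
               w∈words = ∈-filter⁺ (motzkinOfArea? d) (∈-allWords w) good
           in Any.index w∈words , trans (cong f (sym (lookup-index w∈words))) fw≡x)
  where
  words : List (Vec Step n)
  words = List.filter (motzkinOfArea? d) (allWords n)
  word : Fin (T n d) → Vec Step n
  word = List.lookup words
  word-good : ∀ i → MotzkinOfArea d (word i)
  word-good i = proj₂ (∈-filter⁻ (motzkinOfArea? d) {xs = allWords n} (∈-lookup {xs = words} i))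

-- Pairs of coordinate flags

-- For every coordinate: does it belong to the left space, and to the right one?
Label : Set
Label = Bool × Bool

pattern neither = false , false
pattern left = true , false
pattern right = false , true
pattern both = true , true

is : Label → Label → Bool
is l l′ = does (Product.≡-dec Bool._≟_ Bool._≟_ l l′)

data Replace (l l′ : Label) : Vec Label n → Vec Label n → Set where
  here  : ∀ {ls : Vec Label n} → Replace l l′ (l ∷ ls) (l′ ∷ ls)
  there : ∀ {l₀} {ls ls′ : Vec Label n} → Replace l l′ ls ls′ → Replace l l′ (l₀ ∷ ls) (l₀ ∷ ls′)

-- The additive form avoids truncated subtraction. For concrete labels both `iverson` terms compute,
-- leaving equal counts or counts that differ by one.
count-Replace : ∀ (P : Label → Bool) {l l′} {ls ls′ : Vec Label n} → Replace l l′ ls ls′ →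
  iverson (P l′) ℕ.+ count P ls ≡ iverson (P l) ℕ.+ count P ls′
count-Replace P {l} {l′} (here {ls = ls}) = x∙yz≈y∙xz (iverson (P l′)) (iverson (P l)) (count P ls)
count-Replace P {l} {l′} (there {l₀ = l₀} {ls} {ls′} r) = begin
  iverson (P l′) ℕ.+ (iverson (P l₀) ℕ.+ count P ls)  ≡⟨ x∙yz≈y∙xz (iverson (P l′)) (iverson (P l₀)) (count P ls) ⟩
  iverson (P l₀) ℕ.+ (iverson (P l′) ℕ.+ count P ls)  ≡⟨ cong (iverson (P l₀) ℕ.+_) (count-Replace P r) ⟩
  iverson (P l₀) ℕ.+ (iverson (P l) ℕ.+ count P ls′)  ≡⟨ x∙yz≈y∙xz (iverson (P l₀)) (iverson (P l)) (count P ls′) ⟩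
  iverson (P l) ℕ.+ (iverson (P l₀) ℕ.+ count P ls′)  ∎
  where open ≡-Reasoning

replace : ∀ l l′ (ls : Vec Label n) → count (is l) ls ≡ suc k → ∃[ ls′ ] Replace l l′ ls ls′
replace l l′ (l₀ ∷ ls) eq with Product.≡-dec Bool._≟_ Bool._≟_ l l₀
... | yes refl = l′ ∷ ls , here
... | no  _    with ls′ , r ← replace l l′ ls eq = l₀ ∷ ls′ , there r

-- The contrapositive form matches the definition of `coordinateSpace`, so inclusion of the spaces
-- follows by composition.
Grows : (Label → Bool) → Vec Label n → Vec Label n → Set
Grows P ls ls′ = ∀ i → P (Vec.lookup ls′ i) ≡ false → P (Vec.lookup ls i) ≡ false

Replace⇒Grows : ∀ (P : Label → Bool) {l l′} {ls ls′ : Vec Label n} →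
  (P l′ ≡ false → P l ≡ false) → Replace l l′ ls ls′ → Grows P ls ls′
Replace⇒Grows P mono here      zero    = mono
Replace⇒Grows P mono here      (suc i) = id
Replace⇒Grows P mono (there r) zero    = id
Replace⇒Grows P mono (there r) (suc i) = Replace⇒Grows P mono r i

infix 4 _⊑_
_⊑_ : Vec Label n → Vec Label n → Set
ls ⊑ ls′ = Grows proj₁ ls ls′ × Grows proj₂ ls ls′

⊑-trans : ∀ {x y z : Vec Label n} → x ⊑ y → y ⊑ z → x ⊑ z
⊑-trans (f , g) (f′ , g′) = (λ i → f i ∘ f′ i) , λ i → g i ∘ g′ i

-- The state of the construction at height h, after i steps and with m steps
-- to go.
record Counts (i h m : ℕ) (ls : Vec Label n) : Set where
  field
    count-neither : count (is neither) ls ℕ.+ h ≡ m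
    count-left    : count (is left) ls ≡ h
    count-right   : count (is right) ls ≡ h
    count-both    : count (is both) ls ℕ.+ h ≡ i

-- Here `m` is the number of coordinates outside the left space after the step. The bound `h′ ≤ m`
-- leaves two fresh coordinates for `up` and one for `level`; `down` takes its coordinates from the
-- positive height.
advance : ∀ {ls : Vec Label n} → h ⇝ h′ → h′ ≤ m → Counts i h (suc m) ls →
          ∃[ ls′ ] ls ⊑ ls′ × Counts (suc i) h′ m ls′
advance {h = h} {m = m} {ls = ls} up 1+h≤m C
  -- The slack `o` is what remains of the fresh coordinates: there are `2 + o` before the step.
  with o , refl ← ℕ.m≤n⇒∃[o]m+o≡n 1+h≤m
  with free ← ℕ.+-cancelʳ-≡ h (count (is neither) ls) (2 ℕ.+ o)
                (trans (Counts.count-neither C) (cong (2 ℕ.+_) (ℕ.+-comm h o)))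
  with ls₁ , r₁ ← replace neither left ls free
  with free₁ ← ℕ.suc-injective (trans (sym (count-Replace (is neither) r₁)) free)
  with ls₂ , r₂ ← replace neither right ls₁ free₁
  with free₂ ← ℕ.suc-injective (trans (sym (count-Replace (is neither) r₂)) free₁)
  = ls₂ ,
    ⊑-trans {x = ls} {ls₁} {ls₂} (Replace⇒Grows proj₁ (λ _ → refl) r₁ , Replace⇒Grows proj₂ (λ _ → refl) r₁)
            (Replace⇒Grows proj₁ (λ _ → refl) r₂ , Replace⇒Grows proj₂ (λ _ → refl) r₂) ,
    record
    { count-neither = trans (cong (ℕ._+ suc h) free₂) (ℕ.+-comm o (suc h))
    ; count-left    = trans (sym (count-Replace (is left) r₂))
                   (trans (sym (count-Replace (is left) r₁)) (cong suc (Counts.count-left C)))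
    ; count-right   = trans (sym (count-Replace (is right) r₂))
                   (cong suc (trans (sym (count-Replace (is right) r₁)) (Counts.count-right C)))
    ; count-both    = trans (ℕ.+-suc _ h) (cong suc (trans (cong (ℕ._+ h)
                   (trans (sym (count-Replace (is both) r₂)) (sym (count-Replace (is both) r₁))))
                   (Counts.count-both C)))
    }
advance {h = suc h} {ls = ls} down h≤m C
  with ls₁ , r₁ ← replace left both ls (Counts.count-left C)
  with ls₂ , r₂ ← replace right both ls₁ (trans (sym (count-Replace (is right) r₁)) (Counts.count-right C))
  = ls₂ ,
    ⊑-trans {x = ls} {ls₁} {ls₂} (Replace⇒Grows proj₁ id r₁ , Replace⇒Grows proj₂ (λ _ → refl) r₁)
            (Replace⇒Grows proj₁ (λ _ → refl) r₂ , Replace⇒Grows proj₂ id r₂) ,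
    record
    { count-neither = trans (cong (ℕ._+ h)
                   (trans (sym (count-Replace (is neither) r₂)) (sym (count-Replace (is neither) r₁))))
                   (ℕ.suc-injective (trans (sym (ℕ.+-suc _ h)) (Counts.count-neither C)))
    ; count-left    = trans (sym (count-Replace (is left) r₂))
                   (ℕ.suc-injective (trans (sym (count-Replace (is left) r₁)) (Counts.count-left C)))
    ; count-right   = ℕ.suc-injective (trans (sym (count-Replace (is right) r₂))
                   (trans (sym (count-Replace (is right) r₁)) (Counts.count-right C)))
    ; count-both    = trans (cong (ℕ._+ h) (trans (sym (count-Replace (is both) r₂))
                   (cong suc (sym (count-Replace (is both) r₁)))))
                   (cong suc (trans (sym (ℕ.+-suc _ h)) (Counts.count-both C)))
    }
advance {h = h} {m = m} {ls = ls} level h≤m C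
  with o , refl ← ℕ.m≤n⇒∃[o]m+o≡n h≤m
  with free ← ℕ.+-cancelʳ-≡ h (count (is neither) ls) (suc o)
                (trans (Counts.count-neither C) (cong suc (ℕ.+-comm h o)))
  with ls₁ , r ← replace neither both ls free
  = ls₁ , (Replace⇒Grows proj₁ (λ _ → refl) r , Replace⇒Grows proj₂ (λ _ → refl) r) ,
    record
    { count-neither = ℕ.suc-injective (trans (cong (ℕ._+ h) (sym (count-Replace (is neither) r)))
                   (Counts.count-neither C))
    ; count-left    = trans (sym (count-Replace (is left) r)) (Counts.count-left C)
    ; count-right   = trans (sym (count-Replace (is right) r)) (Counts.count-right C)
    ; count-both    = trans (cong (ℕ._+ h) (sym (count-Replace (is both) r)))
                   (cong suc (Counts.count-both C))
    }

-- Iterates `advance`, with `Path⇒≤` supplying its bound. The conclusion `ls ⊑ g j` carries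
-- monotonicity through the induction: the first new labelling lies below all later ones.
labellings : ∀ (v : Vec ℕ k) {ls : Vec Label n} → Path h v → Counts i h (suc k) ls →
  Σ (Fin k → Vec Label n) λ g → (∀ j → ls ⊑ g j) × (∀ {j j′} → j Fin.< j′ → g j ⊑ g j′) ×
    (∀ j → ∃[ m ] Counts (toℕ j ℕ.+ suc i) (Vec.lookup v j) m (g j))
labellings []      _ _ = (λ ()) , (λ ()) , (λ {}) , λ ()
labellings {suc k} {n} {i = i} (x ∷ v) {ls} (h⇝x , path) C
  with ls′ , ls⊑ls′ , C′ ← advance h⇝x (Path⇒≤ v path) C
  with g , ls′⊑g , g-mono , g-counts ← labellings v path C′
  = g′ , ls⊑g′ , (λ {j} {j′} → g′-mono {j} {j′}) , g′-counts
  where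
  g′ : Fin (suc k) → Vec Label n
  g′ zero    = ls′
  g′ (suc j) = g j
  ls⊑g′ : ∀ j → ls ⊑ g′ j
  ls⊑g′ zero    = ls⊑ls′
  ls⊑g′ (suc j) = ⊑-trans {x = ls} {ls′} {g j} ls⊑ls′ (ls′⊑g j)
  g′-mono : ∀ {j j′} → j Fin.< j′ → g′ j ⊑ g′ j′
  g′-mono {zero}  {suc j′} _         = ls′⊑g j′
  g′-mono {suc j} {suc j′} (s≤s j<j′) = g-mono j<j′
  g′-counts : ∀ j → ∃[ m ] Counts (toℕ j ℕ.+ suc i) (Vec.lookup (x ∷ v) j) m (g′ j)
  g′-counts zero    = _ , C′
  g′-counts (suc j) with m , C″ ← g-counts j =
    m , subst (λ z → Counts z (Vec.lookup v j) m (g j)) (ℕ.+-suc (toℕ j) (suc i)) C″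

count-replicate : ∀ (P : A → Bool) {a} n → count P (Vec.replicate n a) ≡ n ℕ.* iverson (P a)
count-replicate P zero    = refl
count-replicate P {a} (suc n) = cong (iverson (P a) ℕ.+_) (count-replicate P n)

count-+ : ∀ (P Q R : A → Bool) → (∀ a → iverson (P a) ≡ iverson (Q a) ℕ.+ iverson (R a)) →
          ∀ (as : Vec A n) → count P as ≡ count Q as ℕ.+ count R as
count-+ P Q R P≡Q+R []       = refl
count-+ P Q R P≡Q+R (a ∷ as) = trans (cong₂ ℕ._+_ (P≡Q+R a) (count-+ P Q R P≡Q+R as))
  (interchange (iverson (Q a)) (iverson (R a)) (count Q as) (count R as))

Counts-initial : ∀ n → Counts 0 0 n (Vec.replicate n neither)
Counts-initial n = record
  { count-neither = trans (ℕ.+-identityʳ _) (trans (count-replicate (is neither) n) (ℕ.*-identityʳ n))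
  ; count-left    = trans (count-replicate (is left) n) (ℕ.*-zeroʳ n)
  ; count-right   = trans (count-replicate (is right) n) (ℕ.*-zeroʳ n)
  ; count-both    = trans (ℕ.+-identityʳ _) (trans (count-replicate (is both) n) (ℕ.*-zeroʳ n))
  }

module _ {ls : Vec Label n} (C : Counts i h m ls) where
  open Counts C

  count-proj₁ : count proj₁ ls ≡ i
  count-proj₁ = trans (count-+ proj₁ (is both) (is left) (λ where
      neither → refl ; left → refl ; right → refl ; both → refl) ls)
    (trans (cong (count (is both) ls ℕ.+_) count-left) count-both)

  count-proj₂ : count proj₂ ls ≡ i
  count-proj₂ = trans (count-+ proj₂ (is both) (is right) (λ where
      neither → refl ; left → refl ; right → refl ; both → refl) ls)
    (trans (cong (count (is both) ls ℕ.+_) count-right) count-both)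

-- Distance vectors

-- `o` is the growth of the dimension of the intersection while both spaces grow by one, so the
-- height changes by `1 - o`.
+-≡⇒⇝ : ∀ o → o ≤ 2 → h′ ℕ.+ o ≡ suc h → h ⇝ h′
+-≡⇒⇝ {h′} 0 _ eq with refl ← trans (sym (ℕ.+-comm h′ 0)) eq = up
+-≡⇒⇝ {h′} 1 _ eq with refl ← ℕ.suc-injective (trans (sym (ℕ.+-comm h′ 1)) eq) = level
+-≡⇒⇝ {h′} 2 _ eq with refl ← ℕ.suc-injective (trans (sym (ℕ.+-comm h′ 2)) eq) = down
+-≡⇒⇝ (suc (suc (suc _))) (s≤s (s≤s ())) _

intersection-dims⇒⇝ : ∀ {m′} → h ℕ.+ m ≡ k → h′ ℕ.+ m′ ≡ suc k → m ≤ m′ → m′ ≤ 2 ℕ.+ m → h ⇝ h′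
intersection-dims⇒⇝ {h} {m} {h′ = h′} refl h′+m′≡ m≤m′ m′≤2+m
  with o , refl ← ℕ.m≤n⇒∃[o]m+o≡n m≤m′ =
  +-≡⇒⇝ o (ℕ.+-cancelˡ-≤ m o 2 (ℕ.≤-trans m′≤2+m (ℕ.≤-reflexive (ℕ.+-comm 2 m))))
    (ℕ.+-cancelʳ-≡ m (h′ ℕ.+ o) (suc h)
      (trans (ℕ.+-assoc h′ o m) (trans (cong (h′ ℕ.+_) (ℕ.+-comm o m)) h′+m′≡)))

module DistanceVectors {c ℓ q} (𝔽 : FiniteField c ℓ q) where
  open Flags 𝔽 hiding (sumℤ)
  open LinearAlgebra 𝔽

  -- The dimension hidden in `InjectionDistance` is the given one by uniqueness, and `m ≤ k` makes
  -- the distance a natural number.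
  injectionDistance-dims : ∀ {U V : Subspace n} {δ} → HasDim U k → InjectionDistance U V δ →
    ∃[ h ] ∃[ m ] HasDim (U ⊓ V) m × h ℕ.+ m ≡ k × δ ≡ + h
  injectionDistance-dims {U = U} {V} dimU (k , m , dimU′ , _ , dim⊓ , δ≡)
    with refl ← HasDim-unique {U = U} dimU dimU′
    with m≤k ← HasDim-mono {U = U ⊓ V} {U} proj₁ dim⊓ dimU
    = k ℕ.∸ m , m , dim⊓ , ℕ.m∸n+n≡m m≤k ,
      trans δ≡ (trans (ℤ.m-n≡m⊖n k m) (ℤ.⊖-≥ m≤k))

  injectionDistance-unique : ∀ {U V : Subspace n} {δ δ′} →
    InjectionDistance U V δ → InjectionDistance U V δ′ → δ ≡ δ′
  injectionDistance-unique {U = U} {V} (k , m , dimU , _ , dim⊓ , refl) (k′ , m′ , dimU′ , _ , dim⊓′ , refl)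
    with refl ← HasDim-unique {U = U} dimU dimU′
    with refl ← HasDim-unique {U = U ⊓ V} dim⊓ dim⊓′
    = refl

  -- The omitted last member of every flag; it provides the final step of the path.
  whole : ∀ n → Subspace n
  whole n = coordinateSpace {n = n} (λ _ → true) (Vec.replicate n tt)

  ∈-whole : ∀ {x : Coord n} → x ∈ ⟦ whole n ⟧
  ∈-whole i ()

  HasDim-whole : ∀ n → HasDim (whole n) n
  HasDim-whole n = subst (HasDim (whole n)) (trans (count-replicate (λ _ → true) n) (ℕ.*-identityʳ n))
    (HasDim-coordinateSpace (λ _ → true) (Vec.replicate n tt))

  hyperplanes⇒⇝ : ∀ {U U′ V V′ : Subspace n} {m′} → ⟦ U ⟧ ⊆ ⟦ U′ ⟧ → ⟦ V ⟧ ⊆ ⟦ V′ ⟧ →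
    HasDim U k → HasDim U′ (suc k) → HasDim V k → HasDim V′ (suc k) →
    HasDim (U ⊓ V) m → HasDim (U′ ⊓ V′) m′ → h ℕ.+ m ≡ k → h′ ℕ.+ m′ ≡ suc k → h ⇝ h′
  hyperplanes⇒⇝ {U = U} {U′} {V} {V′} U⊆U′ V⊆V′ dimU dimU′ dimV dimV′ dim⊓ dim⊓′ h+m≡ h′+m′≡ =
    intersection-dims⇒⇝ h+m≡ h′+m′≡
      (HasDim-mono {U = U ⊓ V} {U′ ⊓ V′} (λ (u , v) → U⊆U′ u , V⊆V′ v) dim⊓ dim⊓′)
      (HasDim-⊓-hyperplanes {U = U} {U′} {V} {V′} U⊆U′ dimU dimU′ V⊆V′ dimV dimV′ dim⊓ dim⊓′)

  DistanceVector⇒Path : ∀ (F F′ : Flag (2 ℕ.+ k)) {x} → DistanceVector F F′ x →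
    ∃[ v ] Path 0 v × x ≡ Vec.map +_ v
  DistanceVector⇒Path {k} F F′ {x} distances =
    Vec.tabulate hs , Path-tabulate hs first inner final , x≡hs
    where
    module X = Flag F
    module X′ = Flag F′
    dims : ∀ i → ∃[ h ] ∃[ m ] HasDim (X.space i ⊓ X′.space i) m × h ℕ.+ m ≡ suc (toℕ i) ×
           Vec.lookup x i ≡ + h
    dims i = injectionDistance-dims {U = X.space i} {X′.space i} (X.dim i) (distances i)
    hs : Fin (suc k) → ℕ
    hs i = proj₁ (dims i)
    first : 0 ⇝ hs zero
    -- The omitted zero spaces have height 0 and intersection of dimension 0; the lines of the flags
    -- meet in dimension at most 1.
    first with h , m , _ , h+m≡1 , _ ← dims zero =
      intersection-dims⇒⇝ {0} {0} refl h+m≡1 z≤n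
        (ℕ.≤-trans (ℕ.m≤n+m m h) (ℕ.≤-trans (ℕ.≤-reflexive h+m≡1) (s≤s z≤n)))
    inner : ∀ i → hs (inject₁ i) ⇝ hs (suc i)
    inner i
      with h , m , dim⊓ , h+m≡ , _ ← dims (inject₁ i) | h′ , m′ , dim⊓′ , h′+m′≡ , _ ← dims (suc i)
      = hyperplanes⇒⇝ {U = X.space (inject₁ i)} {X.space (suc i)} {X′.space (inject₁ i)} {X′.space (suc i)}
          (proj₁ (X.chain i<1+i)) (proj₁ (X′.chain i<1+i))
          (subst (HasDim (X.space (inject₁ i))) suc-toℕ (X.dim (inject₁ i))) (X.dim (suc i))
          (subst (HasDim (X′.space (inject₁ i))) suc-toℕ (X′.dim (inject₁ i))) (X′.dim (suc i))
          dim⊓ dim⊓′ (trans h+m≡ suc-toℕ) h′+m′≡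
      where
      suc-toℕ : suc (toℕ (inject₁ i)) ≡ suc (toℕ i)
      suc-toℕ = cong suc (Fin.toℕ-inject₁ i)
      i<1+i : inject₁ i Fin.< suc i
      i<1+i = ℕ.≤-reflexive suc-toℕ
    final : hs (fromℕ k) ⇝ 0
    -- Both flags are continued by the whole space, whose intersection with itself has full
    -- dimension and hence height 0.
    final with h , m , dim⊓ , h+m≡ , _ ← dims (fromℕ k) =
      hyperplanes⇒⇝ {U = X.space (fromℕ k)} {whole (2 ℕ.+ k)} {X′.space (fromℕ k)} {whole (2 ℕ.+ k)}
        (λ _ → ∈-whole) (λ _ → ∈-whole)
        (subst (HasDim (X.space (fromℕ k))) suc-toℕ (X.dim (fromℕ k))) (HasDim-whole (2 ℕ.+ k))
        (subst (HasDim (X′.space (fromℕ k))) suc-toℕ (X′.dim (fromℕ k))) (HasDim-whole (2 ℕ.+ k))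
        dim⊓ (HasDim-resp {U = whole (2 ℕ.+ k)} {whole (2 ℕ.+ k) ⊓ whole (2 ℕ.+ k)}
          (λ x∈ → x∈ , x∈) proj₁ (HasDim-whole (2 ℕ.+ k)))
        (trans h+m≡ suc-toℕ) refl
      where
      suc-toℕ : suc (toℕ (fromℕ k)) ≡ suc k
      suc-toℕ = cong suc (Fin.toℕ-fromℕ k)
    x≡hs : x ≡ Vec.map +_ (Vec.tabulate hs)
    x≡hs = trans (sym (Vec.tabulate∘lookup x))
      (trans (Vec.tabulate-cong (λ i → proj₂ (proj₂ (proj₂ (proj₂ (dims i))))))
        (Vec.tabulate-∘ +_ hs))

  coordinateFlag : ∀ (P : Label → Bool) (g : Fin k → Vec Label (suc k)) →
    (∀ i → count P (g i) ≡ suc (toℕ i)) →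
    (∀ {i j} → i Fin.< j → Grows P (g i) (g j)) → Flag (suc k)
  coordinateFlag P g count≡ grows = record
    { space = space′
    -- Strictness comes from dimensions: a reverse inclusion would force the larger one below the
    -- smaller.
    ; chain = λ {i} {j} i<j → (λ {x} → space′-⊆ i<j {x}) , λ ⊇ → contradiction
        (HasDim-mono {U = space′ j} {space′ i} ⊇ (dim′ j) (dim′ i)) (ℕ.<⇒≱ (s≤s i<j))
    ; dim   = dim′
    }
    where
    space′ : Fin _ → Subspace _
    space′ i = coordinateSpace P (g i)
    dim′ : ∀ i → HasDim (space′ i) (suc (toℕ i))
    dim′ i = subst (HasDim (space′ i)) (count≡ i) (HasDim-coordinateSpace P (g i))
    space′-⊆ : ∀ {i j} → i Fin.< j → ⟦ space′ i ⟧ ⊆ ⟦ space′ j ⟧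
    space′-⊆ i<j x∈ a out = x∈ a (grows i<j a out)

  coordinateSpace-⊓ : ∀ (ls : Vec Label n) →
    HasDim (coordinateSpace proj₁ ls ⊓ coordinateSpace proj₂ ls) (count (is both) ls)
  coordinateSpace-⊓ ls = HasDim-resp {U = coordinateSpace (is both) ls}
    {coordinateSpace proj₁ ls ⊓ coordinateSpace proj₂ ls}
    (λ x∈ → (λ i out → x∈ i (proj₁-out (Vec.lookup ls i) out)) ,
            (λ i out → x∈ i (proj₂-out (Vec.lookup ls i) out)))
    (λ (x∈ , y∈) i → either-out (Vec.lookup ls i) (x∈ i) (y∈ i))
    (HasDim-coordinateSpace (is both) ls)
    where
    proj₁-out : ∀ l → proj₁ l ≡ false → is both l ≡ false
    proj₁-out neither _ = refl
    proj₁-out right _ = refl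
    proj₂-out : ∀ l → proj₂ l ≡ false → is both l ≡ false
    proj₂-out neither _ = refl
    proj₂-out left _ = refl
    either-out : ∀ {b} {B : Set b} l → (proj₁ l ≡ false → B) → (proj₂ l ≡ false → B) → is both l ≡ false → B
    either-out neither f g _ = f refl
    either-out left f g _ = g refl
    either-out right f g _ = f refl

  coordinateSpaces-injectionDistance : ∀ {ls : Vec Label n} → Counts i h m ls →
    InjectionDistance (coordinateSpace proj₁ ls) (coordinateSpace proj₂ ls) (+ h)
  coordinateSpaces-injectionDistance {i = i} {h = h} {ls = ls} C =
    i , common ,
    subst (HasDim (coordinateSpace proj₁ ls)) (count-proj₁ C) (HasDim-coordinateSpace proj₁ ls) ,
    subst (HasDim (coordinateSpace proj₂ ls)) (count-proj₂ C) (HasDim-coordinateSpace proj₂ ls) ,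
    coordinateSpace-⊓ ls , (begin
      + h                            ≡⟨ cong +_ (ℕ.m+n∸m≡n common h) ⟨
      + (common ℕ.+ h ℕ.∸ common)    ≡⟨ ℤ.⊖-≥ (ℕ.m≤m+n common h) ⟨
      (common ℕ.+ h) ℤ.⊖ common      ≡⟨ ℤ.m-n≡m⊖n (common ℕ.+ h) common ⟨
      + (common ℕ.+ h) ℤ.- + common  ≡⟨ cong (λ z → + z ℤ.- + common) (Counts.count-both C) ⟩
      + i ℤ.- + common               ∎)
    where
    open ≡-Reasoning
    common : ℕ
    common = count (is both) ls

  Path⇒DistanceVector : ∀ (v : Vec ℕ k) → Path 0 v →
    Σ (Flag (suc k)) λ F → Σ (Flag (suc k)) λ F′ → DistanceVector F F′ (Vec.map +_ v)
  Path⇒DistanceVector {k} v path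
    -- The construction starts from two zero spaces, with every coordinate fresh.
    with g , _ , g-mono , g-counts ← labellings v path (Counts-initial (suc k))
    = coordinateFlag proj₁ g (λ i → count-proj₁ (proj₂ (counts i))) (λ i<j → proj₁ (g-mono i<j)) ,
      coordinateFlag proj₂ g (λ i → count-proj₂ (proj₂ (counts i))) (λ i<j → proj₂ (g-mono i<j)) ,
      λ i → subst (InjectionDistance (coordinateSpace proj₁ (g i)) (coordinateSpace proj₂ (g i)))
        (sym (Vec.lookup-map i +_ v)) (coordinateSpaces-injectionDistance (proj₂ (counts i)))
    where
    counts : ∀ i → ∃[ m ] Counts (suc (toℕ i)) (Vec.lookup v i) m (g i)
    counts i with m , C ← g-counts i =
      m , subst (λ z → Counts z (Vec.lookup v i) m (g i)) (ℕ.+-comm (toℕ i) 1) C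

  DistanceVector-unique : ∀ (F F′ : Flag n) {x y} →
    DistanceVector F F′ x → DistanceVector F F′ y → x ≡ y
  DistanceVector-unique F F′ {x} {y} distances distances′ = begin
    x                            ≡⟨ Vec.tabulate∘lookup x ⟨
    Vec.tabulate (Vec.lookup x)  ≡⟨ Vec.tabulate-cong (λ i →
      injectionDistance-unique {U = space F i} {space F′ i} (distances i) (distances′ i)) ⟩
    Vec.tabulate (Vec.lookup y)  ≡⟨ Vec.tabulate∘lookup y ⟩
    y                            ∎
    where open ≡-Reasoning

  𝒟⇒Path : ∀ {d x} → x ∈ 𝒟 d (2 ℕ.+ k) →
    ∃[ v ] Path 0 v × x ≡ Vec.map +_ v × sumℤ x ≡ + d
  𝒟⇒Path {x = x} (F , F′ , distances , y , distances′ , sum≡) =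
    let v , path , x≡v = DistanceVector⇒Path F F′ {x} distances
    in v , path , x≡v ,
       -- The flag distance comes with its own vector `y`, which uniqueness identifies with `x`. The
       -- sum used in `𝒟` and the present `sumℤ` unfold to the same fold.
       trans (cong sumℤ (DistanceVector-unique F F′ {x} {y} distances distances′)) sum≡

  Path⇒𝒟 : ∀ {d} (v : Vec ℕ k) → Path 0 v → sumℤ (Vec.map +_ v) ≡ + d →
    Vec.map +_ v ∈ 𝒟 d (suc k)
  Path⇒𝒟 v path sum≡ =
    let F , F′ , distances = Path⇒DistanceVector v path
    in F , F′ , distances , Vec.map +_ v , distances , sum≡

  𝒟-cardinality : ∀ d → HasCardinality (subset (𝒟 d (2 ℕ.+ k))) (T (2 ℕ.+ k) d)
  𝒟-cardinality {k} d = T-enumeration (2 ℕ.+ k) d (innerHeights (+ 0)) inner∈𝒟 inner-injective inner-surjective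
    where
    inner∈𝒟 : ∀ w → MotzkinOfArea d w → innerHeights (+ 0) w ∈ 𝒟 d (2 ℕ.+ k)
    inner∈𝒟 w (motzkin , area≡) =
      let v , path , inner≡ = IsMotzkinFrom⇒Path 0 w motzkin
      in subst (𝒟 d (2 ℕ.+ k)) (sym inner≡)
        (Path⇒𝒟 v path (trans (cong sumℤ (sym inner≡)) (area⇒sum w motzkin area≡)))
    inner-injective : ∀ {w w′} → MotzkinOfArea d w → MotzkinOfArea d w′ →
      innerHeights (+ 0) w ≡ innerHeights (+ 0) w′ → w ≡ w′
    inner-injective {w} {w′} ((_ , last≡0) , _) ((_ , last′≡0) , _) eq =
      innerHeights-injective (+ 0) w w′ eq (trans last≡0 (sym last′≡0))
    inner-surjective : ∀ {x} → x ∈ 𝒟 d (2 ℕ.+ k) → ∃[ w ] MotzkinOfArea d w × innerHeights (+ 0) w ≡ x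
    inner-surjective x∈𝒟 =
      let v , path , x≡ , sum≡ = 𝒟⇒Path x∈𝒟
          w , motzkin , inner≡ = Path⇒IsMotzkinFrom v path
          inner≡x = trans inner≡ (sym x≡)
      in w , (motzkin , sum⇒area w motzkin (trans (cong sumℤ inner≡x) sum≡)) , inner≡x

corollary4p15 : ∀ {c ℓ} (q : ℕ) → IsPrimePower q → (𝔽 : FiniteField c ℓ q) →
    (n : ℕ) → 2 ≤ n → (d : ℕ) → d ≤ (n ^ 2) / 4 →
    HasCardinality (subset (Flags.𝒟 𝔽 d n)) (T n d)
corollary4p15 q _ 𝔽 (suc (suc n)) _ d _ = DistanceVectors.𝒟-cardinality 𝔽 d
corollary4p15 q _ 𝔽 (suc zero) (s≤s ()) d _
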